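{- Let $v \ge 81$ be an integer. Then \[ \beta(2,v,4) \le \left\lfloor \frac{2v-3}{3} \right\rfloor, \] and \[ \beta(2,v,4) \ge \begin{cases} \frac{2v-6}{3} & \text{if } v \equiv 0 \pmod 3,\\ \frac{2v-8}{3} & \text{if } v \equiv 1 \pmod 3,\\ \frac{2v-4}{3} & \text{if } v \equiv 2 \pmod 3. \end{cases} \]
   Context: For integers $v \ge k \ge 2$, a $(v,k)$-packing is a pair $(X,\mathcal{B})$ where $X$ is a set of $v$ points and $\mathcal{B}$ is a set of $k$-subsets of $X$ (blocks) such that every pair of distinct points lies in at most one block. A partial parallel class (PPC) is a set of pairwise disjoint blocks; its size is the number of blocks. A PPC of size $\rho$ is maximum if the packing has no PPC of size $\rho+1$. $\beta(\rho,v,k)$ denotes the maximum number of blocks in a $(v,k)$-packing in which the maximum PPC has size $\rho$. -}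

module Defs where

open import Data.Bool.Properties using () renaming (_≟_ to _≟ᵇ_)
open import Data.Fin using (Fin; zero; suc; combine)
open import Data.Fin.Properties using (_≟_; all?; combine-injective; pigeonhole; <⇒≢)
open import Data.Fin.Subset as Subset using (Subset; inside; outside; ∣_∣; _∩_; Empty)
open import Data.Fin.Subset.Properties using (_∈?_; nonempty?; anySubset?)
open import Data.List using (List; []; _∷_; length; lookup)
open import Data.List.Membership.Propositional using (_∈_)
open import Data.List.Membership.Propositional.Properties using (∈-lookup)
open import Data.List.Relation.Binary.Subset.Propositional using (_⊆_)
open import Data.List.Relation.Unary.All as All using (All)
open import Data.List.Relation.Unary.AllPairs as AllPairs using (AllPairs; []; _∷_)
open import Data.List.Relation.Unary.Any using (any?)
open import Data.List.Relation.Unary.Unique.Propositional using (Unique)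
open import Data.Nat as ℕ using (ℕ; zero; suc; _^_; _≤_; z≤n; s≤s)
open import Data.Nat.Properties using (≮⇒≥; m≤n⇒m<n∨m≡n)
open import Data.Product using (∃-syntax; _×_; _,_; proj₁; proj₂)
open import Data.Sum using (inj₁; inj₂)
open import Data.Vec using ([]; _∷_)
open import Data.Vec.Properties using (≡-dec)
open import Function using (_∘_)
open import Relation.Binary.Definitions using (DecidableEquality)
open import Relation.Binary.PropositionalEquality
  using (_≡_; _≢_; refl; sym; cong)
open import Level using (0ℓ)
open import Relation.Nullary using (¬_; Dec; yes; no; contradiction)
open import Relation.Nullary.Decidable using (map′; _×-dec_; _→-dec_; ¬?)
open import Relation.Unary using (Pred; Decidable)

private
  variable
    v : ℕ

-- The point set is Fin v.  A finite set of blocks is a duplicate-free list, so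
-- that its cardinality is the length of the list.

record IsPacking (v k : ℕ) (𝓑 : List (Subset v)) : Set where
  field
    distinct   : Unique 𝓑
    block-size : All (λ B → ∣ B ∣ ≡ k) 𝓑
    pair       : ∀ {x y : Fin v} → x ≢ y →
                 ∀ {B C} → B ∈ 𝓑 → C ∈ 𝓑 →
                 x Subset.∈ B → y Subset.∈ B →
                 x Subset.∈ C → y Subset.∈ C → B ≡ C

Disjoint : Subset v → Subset v → Set
Disjoint B C = Empty (B ∩ C)

record IsPPC (𝓑 P : List (Subset v)) : Set where
  field
    distinct : Unique P
    blocks   : P ⊆ 𝓑
    disjoint : AllPairs Disjoint P

HasPPC : List (Subset v) → ℕ → Set
HasPPC 𝓑 ρ = ∃[ P ] length P ≡ ρ × IsPPC 𝓑 P

MaxPPCSize : List (Subset v) → ℕ → Set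
MaxPPCSize 𝓑 ρ = HasPPC 𝓑 ρ × ¬ HasPPC 𝓑 (suc ρ)

Attained : (ρ v k b : ℕ) → Set
Attained ρ v k b =
  ∃[ 𝓑 ] length 𝓑 ≡ b × (IsPacking v k 𝓑 × MaxPPCSize 𝓑 ρ)

_≟ˢ_ : DecidableEquality (Subset v)
_≟ˢ_ = ≡-dec _≟ᵇ_

unique? : Decidable (Unique {A = Subset v})
unique? = AllPairs.allPairs? (λ B C → ¬? (B ≟ˢ C))

anyList? : ∀ b {P : Pred (List (Subset v)) 0ℓ} → Decidable P →
           Dec (∃[ 𝓑 ] length 𝓑 ≡ b × P 𝓑)
anyList? zero P? =
  map′ (λ p → [] , refl , p) (λ { ([] , refl , p) → p }) (P? [])
anyList? (suc b) P? =
  map′ (λ { (B , 𝓑 , refl , p) → B ∷ 𝓑 , refl , p })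
       (λ { (B ∷ 𝓑 , refl , p) → B , 𝓑 , refl , p })
       (anySubset? (λ B → anyList? b (P? ∘ (B ∷_))))

isPacking? : ∀ k → Decidable (IsPacking v k)
isPacking? k 𝓑 = map′
  (λ { (u , s , p) → record
    { distinct = u ; block-size = s
    ; pair = λ x≢y B∈ C∈ → All.lookup (All.lookup (p _ _ x≢y) B∈) C∈ } })
  (λ p → let open IsPacking p in distinct , block-size ,
    λ x y x≢y → All.tabulate λ B∈ → All.tabulate λ C∈ → pair x≢y B∈ C∈)
  (unique? 𝓑 ×-dec All.all? (λ B → ∣ B ∣ ℕ.≟ k) 𝓑 ×-dec
    all? λ x → all? λ y → ¬? (x ≟ y) →-dec
      All.all? (λ B → All.all? (λ C →
        (x ∈? B) →-dec ((y ∈? B) →-dec ((x ∈? C) →-dec ((y ∈? C) →-dec (B ≟ˢ C))))) 𝓑) 𝓑)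

isPPC? : (𝓑 : List (Subset v)) → Decidable (IsPPC 𝓑)
isPPC? 𝓑 P = map′
  (λ { (u , s , d) → record
    { distinct = u ; blocks = All.lookup s ; disjoint = d } })
  (λ p → let open IsPPC p in distinct , All.tabulate blocks , disjoint)
  (unique? P ×-dec All.all? (λ B → any? (B ≟ˢ_) 𝓑) P ×-dec
    AllPairs.allPairs? (λ B C → ¬? (nonempty? (B ∩ C))) P)

hasPPC? : (𝓑 : List (Subset v)) → Decidable (HasPPC 𝓑)
hasPPC? 𝓑 ρ = anyList? ρ (isPPC? 𝓑)

attained? : ∀ ρ v k → Decidable (Attained ρ v k)
attained? ρ v k b = anyList? b λ 𝓑 →
  isPacking? k 𝓑 ×-dec (hasPPC? 𝓑 ρ ×-dec ¬? (hasPPC? 𝓑 (suc ρ)))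

greatest : {P : Pred ℕ 0ℓ} → Decidable P → ℕ → ℕ
greatest P? zero = zero
greatest P? (suc n) with P? (suc n)
... | yes _ = suc n
... | no  _ = greatest P? n

-- A set of blocks on v points has at most 2 ^ v members, so bounding the search
-- loses nothing: see ≤β and β-attained.  If no packing has maximum PPC size ρ,
-- the value is 0.
β : (ρ v k : ℕ) → ℕ
β ρ v k = greatest (attained? ρ v k) (2 ^ v)

private
  encode : Subset v → Fin (2 ^ v)
  encode []            = zero
  encode (outside ∷ B) = combine {2} zero (encode B)
  encode (inside  ∷ B) = combine {2} (suc zero) (encode B)

  encode-injective : (B C : Subset v) → encode B ≡ encode C → B ≡ C
  encode-injective [] [] _ = refl
  encode-injective (outside ∷ B) (outside ∷ C) e =
    cong (outside ∷_) (encode-injective B C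
      (proj₂ (combine-injective {2} zero (encode B) zero (encode C) e)))
  encode-injective (inside ∷ B) (inside ∷ C) e =
    cong (inside ∷_) (encode-injective B C
      (proj₂ (combine-injective {2} (suc zero) (encode B) (suc zero) (encode C) e)))
  encode-injective (outside ∷ B) (inside ∷ C) e
    with () ← proj₁ (combine-injective {2} zero (encode B) (suc zero) (encode C) e)
  encode-injective (inside ∷ B) (outside ∷ C) e
    with () ← proj₁ (combine-injective {2} (suc zero) (encode B) zero (encode C) e)

  lookup-injective : {𝓑 : List (Subset v)} → Unique 𝓑 →
                     ∀ i j → lookup 𝓑 i ≡ lookup 𝓑 j → i ≡ j
  lookup-injective (_ ∷ _)  zero    zero    _ = refl
  lookup-injective (B∉ ∷ _) zero    (suc j) e =
    contradiction e (All.lookup B∉ (∈-lookup j))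
  lookup-injective (B∉ ∷ _) (suc i) zero    e =
    contradiction (sym e) (All.lookup B∉ (∈-lookup i))
  lookup-injective (_ ∷ u)  (suc i) (suc j) e = cong suc (lookup-injective u i j e)

  length≤2^ : {𝓑 : List (Subset v)} → Unique 𝓑 → length 𝓑 ≤ 2 ^ v
  length≤2^ {𝓑 = 𝓑} u = ≮⇒≥ λ lt →
    let i , j , i<j , e = pigeonhole lt (encode ∘ lookup 𝓑)
    in contradiction (lookup-injective u i j (encode-injective _ _ e)) (<⇒≢ i<j)

  ≤greatest : {P : Pred ℕ 0ℓ} (P? : Decidable P) →
              ∀ n {m} → m ≤ n → P m → m ≤ greatest P? n
  ≤greatest P? zero    m≤n _ = m≤n
  ≤greatest P? (suc n) m≤n p with P? (suc n)
  ... | yes _  = m≤n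
  ... | no ¬p with m≤n⇒m<n∨m≡n m≤n
  ...   | inj₁ (s≤s m≤n′) = ≤greatest P? n m≤n′ p
  ...   | inj₂ refl       = contradiction p ¬p

  greatest-holds : {P : Pred ℕ 0ℓ} (P? : Decidable P) →
                   ∀ n {m} → m ≤ n → P m → P (greatest P? n)
  greatest-holds P? zero z≤n p = p
  greatest-holds P? (suc n) m≤n p with P? (suc n)
  ... | yes q  = q
  ... | no ¬p with m≤n⇒m<n∨m≡n m≤n
  ...   | inj₁ (s≤s m≤n′) = greatest-holds P? n m≤n′ p
  ...   | inj₂ refl       = contradiction p ¬p

  attained≤2^ : ∀ ρ v k {b} → Attained ρ v k b → b ≤ 2 ^ v
  attained≤2^ ρ v k (_ , refl , p , _) = length≤2^ (IsPacking.distinct p)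

≤β : ∀ ρ v k {b} → Attained ρ v k b → b ≤ β ρ v k
≤β ρ v k a = ≤greatest (attained? ρ v k) (2 ^ v) (attained≤2^ ρ v k a) a

β-attained : ∀ ρ v k {b} → Attained ρ v k b → Attained ρ v k (β ρ v k)
β-attained ρ v k a = greatest-holds (attained? ρ v k) (2 ^ v) (attained≤2^ ρ v k a) a

{-# OPTIONS --safe #-}

-- Upper bound.  If some point x is on at least 9 blocks, two disjoint blocks missing x would leave a block
-- through x disjoint from both; so the blocks missing x intersect pairwise and either share a point y or
-- number at most 16.  In the first case counting points on the blocks through x, and on the blocks through y
-- that miss x, gives 3 b ≤ (v − 1) + (v − 2).  If all degrees are at most 8, take disjoint blocks A and B.
-- Either all other blocks meet A, and there are few, or some C ≠ B is disjoint from A.  Each point of C not on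
-- B is then on at most 4 blocks missing A, because these meet B; so nearly all incidences with C come from
-- blocks that meet A as well, and counting the incidences with A and C gives b ≤ 52.
--
-- Lower bound.  Take two parallel classes of m triples on 3 m points, no two triples sharing two points, and
-- add a new point to the triples of each class.  Blocks of the same class meet in their new point.

module Submission where

open import Defs
open import Data.Nat using (ℕ; _*_; _∸_; _≤_; _≥_; _/_; _%_)
open import Data.Product using (_×_)
open import Relation.Binary.PropositionalEquality using (_≡_)

open import Data.Bool using (if_then_else_)
open import Data.Fin using (Fin; zero; suc; toℕ; fromℕ<; inject≤; join; splitAt; combine)
open import Data.Fin.Properties as Fin
  using (toℕ-fromℕ<; toℕ<n; toℕ-injective; inject≤-injective; splitAt-join; combine-injective; 0≢1+n)
open import Data.Fin.Subset as Subset using (Subset; inside; outside; ∣_∣; _∩_; _∪_; ⁅_⁆; ⊥)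
open import Data.Fin.Subset.Properties
  using (_∈?_; nonempty?; x∈p∩q⁺; x∈p∩q⁻; x∈p∪q⁺; x∈p∪q⁻; x∈⁅x⁆; x∈⁅y⁆⇒x≡y; ∉⊥; ∣⁅x⁆∣≡1; ∣⊥∣≡0;
         Empty-unique; ∪-identityˡ)
open import Data.List using (List; []; _∷_; length; map; filter; allFin; tabulate; cartesianProduct)
open import Data.List.Membership.Propositional using (_∈_; find; lose)
open import Data.List.Membership.Propositional.Properties
  using (∈-filter⁻; ∈-allFin; ∈-map⁺; ∈-map⁻; ∈-cartesianProduct⁺)
open import Data.List.Properties using (length-tabulate; map-tabulate; length-map; length-++)
open import Data.List.Relation.Unary.All as All using ([]; _∷_)
open import Data.List.Relation.Unary.All.Properties as All using (¬All⇒Any¬)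
open import Data.List.Relation.Unary.AllPairs using (AllPairs; []; _∷_)
open import Data.List.Relation.Unary.Any using (here; there; any?)
open import Data.List.Relation.Unary.Unique.Propositional using (Unique)
open import Data.List.Relation.Unary.Unique.Propositional.Properties as Unique using (allFin⁺)
open import Data.Nat using (zero; suc; _+_; z≤n; s≤s; NonZero)
open import Data.Nat.DivMod
  using (/-monoˡ-≤; m*n/n≡m; m%n<n; m<n⇒m%n≡m; [m+kn]%n≡m%n; %-distribˡ-+; m≡m%n+[m/n]*n)
open import Data.Nat.ListAction using (sum)
open import Data.Nat.Properties hiding (_≟_; 0≢1+n)
open import Data.Nat.Tactic.RingSolver using (solve-∀)
open import Data.Product using (∃; _,_; proj₁; proj₂; uncurry)
open import Data.Product.Properties using (,-injective; ,-injectiveˡ)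
open import Data.Sum using (_⊎_; inj₁; inj₂; map₂)
open import Data.Sum.Properties using (inj₂-injective)
open import Data.Vec as Vec using ([]; _∷_)
open import Data.Vec.Properties using ([]=⇒lookup; lookup⇒[]=)
open import Function using (id; _∘_)
open import Function.Definitions using (Injective)
open import Relation.Binary.PropositionalEquality using (_≢_; refl; sym; trans; cong; cong₂; subst)
open import Relation.Nullary using (¬_; Dec; yes; no; contradiction)
open import Relation.Nullary.Decidable using (¬?; _×-dec_; decidable-stable)

private
  variable
    v : ℕ
    X Y : Set

-- Finite sums over lists.

∑ : List X → (X → ℕ) → ℕ
∑ xs f = sum (map f xs)

∑-syntax = ∑
infix 5 ∑-syntax
syntax ∑-syntax xs (λ x → t) = ∑[ x ∈ xs ] t

∑-cong : ∀ (xs : List X) {f g} → (∀ x → f x ≡ g x) → ∑ xs f ≡ ∑ xs g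
∑-cong []       f≡g = refl
∑-cong (x ∷ xs) f≡g = cong₂ _+_ (f≡g x) (∑-cong xs f≡g)

∑-mono : ∀ (xs : List X) {f g} → (∀ {x} → x ∈ xs → f x ≤ g x) → ∑ xs f ≤ ∑ xs g
∑-mono []       f≤g = z≤n
∑-mono (x ∷ xs) f≤g = +-mono-≤ (f≤g (here refl)) (∑-mono xs (f≤g ∘ there))

∑-+ : ∀ (xs : List X) f g → (∑[ x ∈ xs ] (f x + g x)) ≡ ∑ xs f + ∑ xs g
∑-+ []       f g = refl
∑-+ (x ∷ xs) f g = trans (cong (f x + g x +_) (∑-+ xs f g)) (interchange (f x) (g x) (∑ xs f) (∑ xs g))
  where
  interchange : ∀ a b c d → (a + b) + (c + d) ≡ (a + c) + (b + d)
  interchange = solve-∀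

∑-const : ∀ (xs : List X) c → (∑[ _ ∈ xs ] c) ≡ length xs * c
∑-const []       c = refl
∑-const (x ∷ xs) c = cong (c +_) (∑-const xs c)

∑-*ˡ : ∀ (xs : List X) c f → (∑[ x ∈ xs ] (c * f x)) ≡ c * ∑ xs f
∑-*ˡ []       c f = sym (*-zeroʳ c)
∑-*ˡ (x ∷ xs) c f = trans (cong (c * f x +_) (∑-*ˡ xs c f)) (sym (*-distribˡ-+ c _ _))

∑-*ʳ : ∀ (xs : List X) c f → (∑[ x ∈ xs ] (f x * c)) ≡ ∑ xs f * c
∑-*ʳ xs c f = trans (∑-cong xs λ x → *-comm (f x) c) (trans (∑-*ˡ xs c f) (*-comm c _))

∑-swap : ∀ (xs : List X) (ys : List Y) (f : X → Y → ℕ) →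
         (∑[ x ∈ xs ] ∑[ y ∈ ys ] f x y) ≡ (∑[ y ∈ ys ] ∑[ x ∈ xs ] f x y)
∑-swap []       ys f = sym (trans (∑-const ys 0) (*-zeroʳ (length ys)))
∑-swap (x ∷ xs) ys f = trans (cong (∑ ys (f x) +_) (∑-swap xs ys f)) (sym (∑-+ ys (f x) _))

f≤∑f : ∀ {xs : List X} {x} f → x ∈ xs → f x ≤ ∑ xs f
f≤∑f f (here refl) = m≤m+n _ _
f≤∑f f (there x∈)  = ≤-trans (f≤∑f f x∈) (m≤n+m _ _)

-- A positive head leaves only zeros behind it: a later entry with a positive value would equal the
-- head, against `Unique`.
∑≤1 : ∀ {xs : List X} {f} → Unique xs → (∀ x → f x ≤ 1) →
      (∀ {x y} → x ∈ xs → y ∈ xs → 1 ≤ f x → 1 ≤ f y → x ≡ y) → ∑ xs f ≤ 1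
∑≤1 [] f≤1 eq = z≤n
∑≤1 {xs = x ∷ xs} {f} (x∉ ∷ u) f≤1 eq with f x in fx≡
... | zero = ∑≤1 u f≤1 λ y∈ z∈ → eq (there y∈) (there z∈)
... | suc n = begin
    suc n + ∑ xs f           ≡⟨ cong (_+ ∑ xs f) fx≡ ⟨
    f x + ∑ xs f             ≤⟨ +-mono-≤ (f≤1 x) (∑-mono xs rest≤0) ⟩
    1 + (∑[ _ ∈ xs ] 0)      ≡⟨ cong suc (trans (∑-const xs 0) (*-zeroʳ (length xs))) ⟩
    1 ∎
  where
  open ≤-Reasoning
  rest≤0 : ∀ {y} → y ∈ xs → f y ≤ 0
  rest≤0 {y} y∈ = ≮⇒≥ λ 0<fy → All.lookup x∉ y∈
    (eq (here refl) (there y∈) (≤-trans (s≤s z≤n) (≤-reflexive (sym fx≡))) 0<fy)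

-- Indicators of subsets and intersection numbers.

ι : Subset v → Fin v → ℕ
ι A z = if Vec.lookup A z then 1 else 0

ι≤1 : ∀ (A : Subset v) z → ι A z ≤ 1
ι≤1 A z with Vec.lookup A z
... | inside  = s≤s z≤n
... | outside = z≤n

∈⇒ι≡1 : ∀ {A : Subset v} {z} → z Subset.∈ A → ι A z ≡ 1
∈⇒ι≡1 z∈A = cong (if_then 1 else 0) ([]=⇒lookup z∈A)

1≤ι⇒∈ : ∀ {A : Subset v} {z} → 1 ≤ ι A z → z Subset.∈ A
1≤ι⇒∈ {A = A} {z} 1≤ι with Vec.lookup A z in eq
... | inside  = lookup⇒[]= z A eq
1≤ι⇒∈ () | outside

∉⇒ι≡0 : ∀ {A : Subset v} {z} → ¬ z Subset.∈ A → ι A z ≡ 0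
∉⇒ι≡0 {A = A} {z} z∉A = n≤0⇒n≡0 (≮⇒≥ (z∉A ∘ 1≤ι⇒∈))

ιι≤1 : ∀ (A B : Subset v) y z → ι A y * ι B z ≤ 1
ιι≤1 A B y z = *-mono-≤ (ι≤1 A y) (ι≤1 B z)

1≤ιι⇒∈ : ∀ {A B : Subset v} {y z} → 1 ≤ ι A y * ι B z → y Subset.∈ A × z Subset.∈ B
1≤ιι⇒∈ {A = A} {B} {y} {z} 1≤ =
  1≤ι⇒∈ (≤-trans 1≤ (≤-trans (*-monoʳ-≤ (ι A y) (ι≤1 B z)) (≤-reflexive (*-identityʳ _)))) ,
  1≤ι⇒∈ (≤-trans 1≤ (≤-trans (*-monoˡ-≤ (ι B z) (ι≤1 A y)) (≤-reflexive (*-identityˡ _))))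

∑ι≡∣∣ : ∀ (A : Subset v) → ∑ (allFin v) (ι A) ≡ ∣ A ∣
∑ι≡∣∣ A = trans (cong sum (map-tabulate id (ι A))) (go A)
  where
  go : ∀ {n} (A : Subset n) → sum (tabulate (ι A)) ≡ ∣ A ∣
  go []            = refl
  go (inside  ∷ A) = cong suc (go A)
  go (outside ∷ A) = go A

infix 8 _⊓_
-- The size of the intersection, written as a sum over points so that it can be interchanged with
-- sums over blocks.
_⊓_ : Subset v → Subset v → ℕ
A ⊓ B = ∑[ z ∈ allFin _ ] (ι A z * ι B z)

disjoint⇒⊓≡0 : ∀ {A B : Subset v} → Disjoint A B → A ⊓ B ≡ 0
disjoint⇒⊓≡0 {v} {A} {B} dis = n≤0⇒n≡0 (≤-trans
  (∑-mono (allFin v) {g = λ _ → 0} λ {z} _ → ≮⇒≥ λ 0<ιι → dis (z , x∈p∩q⁺ (1≤ιι⇒∈ 0<ιι)))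
  (≤-reflexive (trans (∑-const (allFin v) 0) (*-zeroʳ (length (allFin v))))))

1≤⊓⊎disjoint : ∀ (A B : Subset v) → 1 ≤ A ⊓ B ⊎ Disjoint A B
1≤⊓⊎disjoint A B with nonempty? (A ∩ B)
... | no  ∩-empty  = inj₂ ∩-empty
... | yes (z , z∈) = let z∈A , z∈B = x∈p∩q⁻ A B z∈ in
  inj₁ (≤-trans (≤-reflexive (sym (cong₂ _*_ (∈⇒ι≡1 z∈A) (∈⇒ι≡1 z∈B))))
                (f≤∑f (λ z → ι A z * ι B z) (∈-allFin z)))

disjoint-sym : ∀ {A B : Subset v} → Disjoint A B → Disjoint B A
disjoint-sym {A = A} {B} dis (z , z∈) = let z∈B , z∈A = x∈p∩q⁻ B A z∈ in dis (z , x∈p∩q⁺ (z∈A , z∈B))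

disjoint⇒∉ : ∀ {A B : Subset v} → Disjoint A B → ∀ {z} → z Subset.∈ A → ¬ z Subset.∈ B
disjoint⇒∉ dis z∈A z∈B = dis (_ , x∈p∩q⁺ (z∈A , z∈B))

disjoint⇒≢ : ∀ {A B : Subset v} {z} → z Subset.∈ A → Disjoint A B → A ≢ B
disjoint⇒≢ z∈A dis refl = disjoint⇒∉ dis z∈A z∈A

-- Double counting of incidences between points and blocks.

module _ (𝓑 : List (Subset v)) where

  -- The total weight of the blocks through `z`. The weight `λ D → ι D x` gives the number of blocks
  -- through both `x` and `z`; the weight `A ⊓_` counts the incidences of these blocks with `A`.
  pencil : (Subset v → ℕ) → Fin v → ℕ
  pencil w z = ∑[ D ∈ 𝓑 ] (ι D z * w D)

  deg : Fin v → ℕ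
  deg z = ∑[ D ∈ 𝓑 ] ι D z

  -- Both sides sum `u z * ι D z * w D` over all points and blocks, once by points and once by
  -- blocks.
  double-count : ∀ (u : Fin v → ℕ) (w : Subset v → ℕ) →
    (∑[ z ∈ allFin v ] (u z * pencil w z)) ≡ (∑[ D ∈ 𝓑 ] ((∑[ z ∈ allFin v ] (u z * ι D z)) * w D))
  double-count u w = begin-equality
    (∑[ z ∈ allFin v ] (u z * pencil w z))
      ≡⟨ ∑-cong (allFin v) (λ z → sym (∑-*ˡ 𝓑 (u z) _)) ⟩
    (∑[ z ∈ allFin v ] ∑[ D ∈ 𝓑 ] (u z * (ι D z * w D)))
      ≡⟨ ∑-swap (allFin v) 𝓑 _ ⟩
    (∑[ D ∈ 𝓑 ] ∑[ z ∈ allFin v ] (u z * (ι D z * w D)))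
      ≡⟨ ∑-cong 𝓑 (λ D → trans (∑-cong (allFin v) λ z → sym (*-assoc (u z) _ _)) (∑-*ʳ (allFin v) (w D) _)) ⟩
    (∑[ D ∈ 𝓑 ] ((∑[ z ∈ allFin v ] (u z * ι D z)) * w D)) ∎
    where open ≤-Reasoning

  ∑deg : ∀ (A : Subset v) → (∑[ z ∈ allFin v ] (ι A z * deg z)) ≡ (∑[ D ∈ 𝓑 ] (A ⊓ D))
  ∑deg A = begin-equality
    (∑[ z ∈ allFin v ] (ι A z * deg z))
      ≡⟨ ∑-cong (allFin v) (λ z → cong (ι A z *_) (∑-cong 𝓑 λ D → sym (*-identityʳ (ι D z)))) ⟩
    (∑[ z ∈ allFin v ] (ι A z * pencil (λ _ → 1) z))
      ≡⟨ double-count (ι A) (λ _ → 1) ⟩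
    (∑[ D ∈ 𝓑 ] ((A ⊓ D) * 1))
      ≡⟨ ∑-cong 𝓑 (λ D → *-identityʳ (A ⊓ D)) ⟩
    (∑[ D ∈ 𝓑 ] (A ⊓ D)) ∎
    where open ≤-Reasoning

  deg≤pencil : ∀ {w} x → (∀ {D} → D ∈ 𝓑 → x Subset.∈ D → 1 ≤ w D) → deg x ≤ pencil w x
  deg≤pencil {w} x 1≤w = ∑-mono 𝓑 term
    where
    term : ∀ {D} → D ∈ 𝓑 → ι D x ≤ ι D x * w D
    term {D} D∈ with x ∈? D
    ... | yes x∈D = ≤-trans (≤-reflexive (sym (*-identityʳ _))) (*-monoʳ-≤ (ι D x) (1≤w D∈ x∈D))
    ... | no  x∉D = ≤-trans (≤-reflexive (∉⇒ι≡0 x∉D)) z≤n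

  length≡deg+avoid : ∀ x → length 𝓑 ≡ deg x + length (filter (λ D → ¬? (x ∈? D)) 𝓑)
  length≡deg+avoid x = go 𝓑
    where
    go : ∀ 𝓛 → length 𝓛 ≡ (∑[ D ∈ 𝓛 ] ι D x) + length (filter (λ D → ¬? (x ∈? D)) 𝓛)
    go []      = refl
    go (D ∷ 𝓛) with x ∈? D
    ... | yes x∈D rewrite ∈⇒ι≡1 x∈D = cong suc (go 𝓛)
    ... | no  x∉D rewrite ∉⇒ι≡0 x∉D = trans (cong suc (go 𝓛)) (sym (+-suc _ _))

  -- Every block contributes at least 1 to the sum of `A ⊓ D`, and by `∑deg` that sum is the total
  -- degree of the points of `A`.
  length≤∑⊓ : ∀ A → (∀ {D} → D ∈ 𝓑 → 1 ≤ A ⊓ D) → ∀ d → (∀ {z} → z Subset.∈ A → deg z ≤ d) →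
              length 𝓑 ≤ ∣ A ∣ * d
  length≤∑⊓ A meets d deg≤d = begin
    length 𝓑                             ≡⟨ trans (sym (*-identityʳ _)) (sym (∑-const 𝓑 1)) ⟩
    (∑[ _ ∈ 𝓑 ] 1)                       ≤⟨ ∑-mono 𝓑 meets ⟩
    (∑[ D ∈ 𝓑 ] (A ⊓ D))                 ≡⟨ ∑deg A ⟨
    (∑[ z ∈ allFin v ] (ι A z * deg z))  ≤⟨ ∑-mono (allFin v) (λ {z} _ → term z) ⟩
    (∑[ z ∈ allFin v ] (ι A z * d))      ≡⟨ ∑-*ʳ (allFin v) d (ι A) ⟩
    ∑ (allFin v) (ι A) * d               ≡⟨ cong (_* d) (∑ι≡∣∣ A) ⟩
    ∣ A ∣ * d ∎
    where
    open ≤-Reasoning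
    term : ∀ z → ι A z * deg z ≤ ι A z * d
    term z with z ∈? A
    ... | yes z∈A = *-monoʳ-≤ (ι A z) (deg≤d z∈A)
    ... | no  z∉A rewrite ∉⇒ι≡0 z∉A = z≤n

-- Degree bounds in packings.

filter-packing : ∀ {k} {𝓑 : List (Subset v)} {P : Subset v → Set} (P? : ∀ D → Dec (P D)) →
                 IsPacking v k 𝓑 → IsPacking v k (filter P? 𝓑)
filter-packing P? packing = record
  { distinct   = Unique.filter⁺ P? distinct
  ; block-size = All.filter⁺ P? block-size
  ; pair       = λ x≢y B∈ C∈ → pair x≢y (proj₁ (∈-filter⁻ P? B∈)) (proj₁ (∈-filter⁻ P? C∈))
  }
  where open IsPacking packing

module _ {k} {𝓑 : List (Subset v)} (packing : IsPacking v k 𝓑) where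

  open IsPacking packing

  ∣block∣ : ∀ {D} → D ∈ 𝓑 → ∣ D ∣ ≡ k
  ∣block∣ = All.lookup block-size

  codeg≤1 : ∀ {x z} → x ≢ z → pencil 𝓑 (λ D → ι D x) z ≤ 1
  codeg≤1 {x} {z} x≢z = ∑≤1 distinct (λ D → ιι≤1 D D z x) λ B∈ C∈ 1≤B 1≤C →
    let z∈B , x∈B = 1≤ιι⇒∈ 1≤B
        z∈C , x∈C = 1≤ιι⇒∈ 1≤C
    in pair x≢z B∈ C∈ x∈B z∈B x∈C z∈C

  ⊓≤1 : ∀ {A D} → A ∈ 𝓑 → D ∈ 𝓑 → A ≢ D → A ⊓ D ≤ 1
  ⊓≤1 {A} {D} A∈ D∈ A≢D = ∑≤1 (allFin⁺ v) (λ z → ιι≤1 A D z z) λ {x} {y} _ _ 1≤x 1≤y →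
    let x∈A , x∈D = 1≤ιι⇒∈ 1≤x
        y∈A , y∈D = 1≤ιι⇒∈ 1≤y
    in decidable-stable (x Fin.≟ y) λ x≢y → A≢D (pair x≢y A∈ D∈ x∈A y∈A x∈D y∈D)

  -- Double counting turns the left side into a sum over `z` in `A` of the number of blocks through
  -- `z` and `x`. Each such number is at most 1, since `x` is off `A` and so differs from `z`.
  pencil⊓≤∣∣ : ∀ A {x} → ¬ x Subset.∈ A → pencil 𝓑 (A ⊓_) x ≤ ∣ A ∣
  pencil⊓≤∣∣ A {x} x∉A = begin
    pencil 𝓑 (A ⊓_) x                                     ≡⟨ ∑-cong 𝓑 (λ D → *-comm (ι D x) (A ⊓ D)) ⟩
    (∑[ D ∈ 𝓑 ] ((A ⊓ D) * ι D x))                        ≡⟨ double-count 𝓑 (ι A) (λ D → ι D x) ⟨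
    (∑[ z ∈ allFin v ] (ι A z * pencil 𝓑 (λ D → ι D x) z)) ≤⟨ ∑-mono (allFin v) (λ {z} _ → term z) ⟩
    ∑ (allFin v) (ι A)                                    ≡⟨ ∑ι≡∣∣ A ⟩
    ∣ A ∣ ∎
    where
    open ≤-Reasoning
    term : ∀ z → ι A z * pencil 𝓑 (λ D → ι D x) z ≤ ι A z
    term z with z ∈? A
    ... | yes z∈A = ≤-trans (*-monoʳ-≤ (ι A z) (codeg≤1 λ { refl → x∉A z∈A })) (≤-reflexive (*-identityʳ _))
    ... | no  z∉A rewrite ∉⇒ι≡0 z∉A = z≤n

  deg≤∣∣ : ∀ A {x} → ¬ x Subset.∈ A → (∀ {D} → D ∈ 𝓑 → 1 ≤ A ⊓ D) → deg 𝓑 x ≤ ∣ A ∣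
  deg≤∣∣ A {x} x∉A meets = ≤-trans (deg≤pencil 𝓑 x λ D∈ _ → meets D∈) (pencil⊓≤∣∣ A x∉A)

  -- The block sizes at y sum to k · deg y; here y itself is counted deg y times and every other point at most
  -- once.  u may count further points, off all blocks through y.
  deg-bound : ∀ y (u : Fin v → ℕ) → (∀ z → y ≢ z → pencil 𝓑 (λ D → ι D y) z + u z ≤ 1) → u y ≡ 0 →
              k * deg 𝓑 y + ∑ (allFin v) u + 1 ≤ v + deg 𝓑 y
  deg-bound y u co≤1 uy≡0 = begin
    k * deg 𝓑 y + ∑ F u + 1                      ≡⟨ cong (λ t → t + ∑ F u + 1) codeg-sum ⟨
    -- The `1` becomes the sum of the indicator of `y`, so that the inequality can be checked point
    -- by point: at `y` the codegree term is at most `deg 𝓑 y`, elsewhere `co≤1` applies.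
    ∑ F co + ∑ F u + 1                           ≡⟨ cong₂ _+_ (∑-+ F co u) (trans (∑ι≡∣∣ ⁅ y ⁆) (∣⁅x⁆∣≡1 y)) ⟨
    (∑[ z ∈ F ] (co z + u z)) + ∑ F (ι ⁅ y ⁆)    ≡⟨ ∑-+ F _ _ ⟨
    (∑[ z ∈ F ] (co z + u z + ι ⁅ y ⁆ z))        ≤⟨ ∑-mono F (λ {z} _ → term z) ⟩
    (∑[ z ∈ F ] (1 + ι ⁅ y ⁆ z * deg 𝓑 y))       ≡⟨ ∑-+ F _ _ ⟩
    (∑[ _ ∈ F ] 1) + (∑[ z ∈ F ] (ι ⁅ y ⁆ z * deg 𝓑 y))
      ≡⟨ cong₂ _+_ (trans (∑-const F 1) (trans (*-identityʳ _) (length-tabulate {n = v} id)))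
                   (trans (∑-*ʳ F (deg 𝓑 y) (ι ⁅ y ⁆))
                     (trans (cong (_* deg 𝓑 y) (trans (∑ι≡∣∣ ⁅ y ⁆) (∣⁅x⁆∣≡1 y))) (*-identityˡ _))) ⟩
    v + deg 𝓑 y ∎
    where
    open ≤-Reasoning
    F = allFin v
    co = pencil 𝓑 (λ D → ι D y)

    codeg-sum : ∑ F co ≡ k * deg 𝓑 y
    codeg-sum = begin-equality
      ∑ F co                            ≡⟨ ∑-cong F (λ z → sym (*-identityˡ (co z))) ⟩
      (∑[ z ∈ F ] (1 * co z))           ≡⟨ double-count 𝓑 (λ _ → 1) (λ D → ι D y) ⟩
      (∑[ D ∈ 𝓑 ] ((∑[ z ∈ F ] (1 * ι D z)) * ι D y))
        ≡⟨ ∑-cong 𝓑 (λ D → cong (_* ι D y) (trans (∑-cong F λ z → *-identityˡ (ι D z)) (∑ι≡∣∣ D))) ⟩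
      (∑[ D ∈ 𝓑 ] (∣ D ∣ * ι D y))
        -- Block sizes are known only for members of `𝓑`, while `∑-cong` asks for all subsets; hence
        -- two inequalities.
        ≡⟨ ≤-antisym (∑-mono 𝓑 λ {D} D∈ → ≤-reflexive (cong (_* ι D y) (∣block∣ D∈)))
                     (∑-mono 𝓑 λ {D} D∈ → ≤-reflexive (cong (_* ι D y) (sym (∣block∣ D∈)))) ⟩
      (∑[ D ∈ 𝓑 ] (k * ι D y))          ≡⟨ ∑-*ˡ 𝓑 k _ ⟩
      k * deg 𝓑 y ∎

    co-y≤deg : co y ≤ deg 𝓑 y
    co-y≤deg = ∑-mono 𝓑 λ {D} _ → ≤-trans (*-monoʳ-≤ (ι D y) (ι≤1 D y)) (≤-reflexive (*-identityʳ _))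

    term : ∀ z → co z + u z + ι ⁅ y ⁆ z ≤ 1 + ι ⁅ y ⁆ z * deg 𝓑 y
    term z with z ∈? ⁅ y ⁆
    ... | no z∉ rewrite ∉⇒ι≡0 z∉ | +-identityʳ (co z + u z) = co≤1 z λ { refl → z∉ (x∈⁅x⁆ y) }
    ... | yes z∈ with refl ← x∈⁅y⁆⇒x≡y y z∈ rewrite ∈⇒ι≡1 z∈ | uy≡0 | +-identityʳ (co z) | +-identityʳ (deg 𝓑 z)
          | +-comm (co z) 1 = s≤s co-y≤deg

pencil-+ : ∀ (𝓑 : List (Subset v)) w₁ w₂ z →
           pencil 𝓑 (λ D → w₁ D + w₂ D) z ≡ pencil 𝓑 w₁ z + pencil 𝓑 w₂ z
pencil-+ 𝓑 w₁ w₂ z = trans (∑-cong 𝓑 λ D → *-distribˡ-+ (ι D z) (w₁ D) (w₂ D)) (∑-+ 𝓑 _ _)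

block-nonempty : ∀ {k} {𝓑 : List (Subset v)} → IsPacking v (suc k) 𝓑 →
                 ∀ {D} → D ∈ 𝓑 → ∃ λ z → z Subset.∈ D
block-nonempty {v} packing {D} D∈ with nonempty? D
... | yes z   = z
... | no ¬z with () ← trans (sym (∣block∣ packing D∈)) (trans (cong ∣_∣ (Empty-unique ¬z)) (∣⊥∣≡0 v))

deg-bound₀ : ∀ {k} {𝓑 : List (Subset v)} → IsPacking v k 𝓑 →
             ∀ y → k * deg 𝓑 y + 1 ≤ v + deg 𝓑 y
deg-bound₀ {v} {k} {𝓑} packing y = ≤-trans (≤-reflexive (cong (_+ 1) (sym zero-sum)))
  (deg-bound packing y (λ _ → 0)
    (λ z y≢z → ≤-trans (≤-reflexive (+-identityʳ _)) (codeg≤1 packing y≢z)) refl)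
  where
  zero-sum : k * deg 𝓑 y + (∑[ _ ∈ allFin v ] 0) ≡ k * deg 𝓑 y
  zero-sum = trans (cong (k * deg 𝓑 y +_) (trans (∑-const (allFin v) 0) (*-zeroʳ (length (allFin v))))) (+-identityʳ _)

-- The point `x` is off all blocks, so its indicator can serve as `u` in `deg-bound`; this improves
-- `deg-bound₀` by 1.
deg-bound₁ : ∀ {k} {𝓑 : List (Subset v)} → IsPacking v k 𝓑 →
             ∀ {x y} → y ≢ x → (∀ {D} → D ∈ 𝓑 → ¬ x Subset.∈ D) → k * deg 𝓑 y + 2 ≤ v + deg 𝓑 y
deg-bound₁ {v} {k} {𝓑} packing {x} {y} y≢x avoids = begin
  k * deg 𝓑 y + 2                                ≡⟨ +-assoc (k * deg 𝓑 y) 1 1 ⟨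
  k * deg 𝓑 y + 1 + 1                            ≡⟨ cong (λ t → k * deg 𝓑 y + t + 1) (trans (∑ι≡∣∣ ⁅ x ⁆) (∣⁅x⁆∣≡1 x)) ⟨
  k * deg 𝓑 y + ∑ (allFin v) (ι ⁅ x ⁆) + 1       ≤⟨ deg-bound packing y (ι ⁅ x ⁆) co≤1 (∉⇒ι≡0 (y≢x ∘ x∈⁅y⁆⇒x≡y x)) ⟩
  v + deg 𝓑 y ∎
  where
  open ≤-Reasoning
  co≤1 : ∀ z → y ≢ z → pencil 𝓑 (λ D → ι D y) z + ι ⁅ x ⁆ z ≤ 1
  co≤1 z y≢z with z ∈? ⁅ x ⁆
  ... | no z∉ rewrite ∉⇒ι≡0 z∉ = ≤-trans (≤-reflexive (+-identityʳ _)) (codeg≤1 packing y≢z)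
  ... | yes z∈ with refl ← x∈⁅y⁆⇒x≡y x z∈ = +-mono-≤ co≤0 (ι≤1 ⁅ z ⁆ z)
    where
    co≤0 : pencil 𝓑 (λ D → ι D y) z ≤ 0
    co≤0 = ≤-trans (∑-mono 𝓑 {g = λ _ → 0} λ {D} D∈ → ≤-reflexive (cong (_* ι D y) (∉⇒ι≡0 (avoids D∈))))
                   (≤-reflexive (trans (∑-const 𝓑 0) (*-zeroʳ (length 𝓑))))

-- If no point is on all blocks, each point is off some block, which its own blocks meet in distinct points.
intersecting-bound : ∀ {𝓑 : List (Subset v)} {x} → v ≥ 50 → IsPacking v 4 𝓑 →
                     (∀ {D} → D ∈ 𝓑 → ¬ x Subset.∈ D) →
                     (∀ {A B} → A ∈ 𝓑 → B ∈ 𝓑 → 1 ≤ A ⊓ B) →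
                     3 * length 𝓑 + 2 ≤ v
-- The empty list is separate because there even `x` is vacuously on all blocks, while below a
-- common point `y` has to differ from `x`.
intersecting-bound {𝓑 = []} v≥50 packing avoids meets = ≤-trans (≤ᵇ⇒≤ 2 50 _) v≥50
intersecting-bound {v} {𝓑 = Y ∷ 𝓛} {x} v≥50 packing avoids meets
  with Fin.any? (λ y → All.all? (y ∈?_) (Y ∷ 𝓛))
... | yes (y , y∈@(y∈Y ∷ _)) = +-cancelʳ-≤ (deg 𝓑 y) _ _ (begin
    3 * length 𝓑 + 2 + deg 𝓑 y  ≡⟨ cong (λ t → 3 * t + 2 + deg 𝓑 y) length≡deg ⟩
    3 * deg 𝓑 y + 2 + deg 𝓑 y   ≡⟨ rearrange (deg 𝓑 y) ⟩
    4 * deg 𝓑 y + 2             ≤⟨ deg-bound₁ packing (λ { refl → avoids (here refl) y∈Y }) avoids ⟩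
    v + deg 𝓑 y ∎)
  where
  open ≤-Reasoning
  𝓑 = Y ∷ 𝓛
  rearrange : ∀ d → 3 * d + 2 + d ≡ 4 * d + 2
  rearrange = solve-∀
  length≡deg : length 𝓑 ≡ deg 𝓑 y
  length≡deg = trans (sym (trans (∑-const 𝓑 1) (*-identityʳ _)))
    (≤-antisym (∑-mono 𝓑 λ D∈ → ≤-reflexive (sym (∈⇒ι≡1 (All.lookup y∈ D∈))))
               (∑-mono 𝓑 λ D∈ → ≤-reflexive (∈⇒ι≡1 (All.lookup y∈ D∈))))
... | no ¬star = begin
    3 * length 𝓑 + 2  ≤⟨ +-monoˡ-≤ 2 (*-monoʳ-≤ 3 length≤16) ⟩
    -- The number is `3 * 16 + 2`, with at most 4 blocks through each of the 4 points of `Y`.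
    50                ≤⟨ v≥50 ⟩
    v ∎
  where
  open ≤-Reasoning
  𝓑 = Y ∷ 𝓛
  deg≤4 : ∀ z → deg 𝓑 z ≤ 4
  deg≤4 z with find (¬All⇒Any¬ (z ∈?_) 𝓑 (λ z∈ → ¬star (z , z∈)))
  ... | D , D∈ , z∉D = subst (deg 𝓑 z ≤_) (∣block∣ packing D∈) (deg≤∣∣ packing D z∉D (meets D∈))
  length≤16 : length 𝓑 ≤ 16
  length≤16 = subst (λ t → length 𝓑 ≤ t * 4) (∣block∣ packing (here refl))
    (length≤∑⊓ 𝓑 Y (meets (here refl)) 4 (λ {z} _ → deg≤4 z))

-- Upper bound for packings without three pairwise disjoint blocks.

module _ {𝓑 : List (Subset v)} (packing : IsPacking v 4 𝓑) (no3 : ¬ HasPPC 𝓑 3) where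

  -- A block `D` disjoint from both would complete `A` and `B` to a PPC of size 3; its members are
  -- distinct because disjoint nonempty blocks differ.
  meets-pair : ∀ {A B D} → A ∈ 𝓑 → B ∈ 𝓑 → D ∈ 𝓑 → Disjoint A B → 1 ≤ A ⊓ D + B ⊓ D
  meets-pair {A} {B} {D} A∈ B∈ D∈ A∥B with 1≤⊓⊎disjoint A D | 1≤⊓⊎disjoint B D
  ... | inj₁ 1≤ | _       = ≤-trans 1≤ (m≤m+n _ _)
  ... | inj₂ _  | inj₁ 1≤ = ≤-trans 1≤ (m≤n+m _ _)
  ... | inj₂ A∥D | inj₂ B∥D = contradiction
    (A ∷ B ∷ D ∷ [] , refl , record
      { distinct = (a≢ A∥B ∷ a≢ A∥D ∷ []) ∷ (disjoint⇒≢ (proj₂ (block-nonempty packing B∈)) B∥D ∷ []) ∷ [] ∷ []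
      ; blocks   = λ { (here refl) → A∈ ; (there (here refl)) → B∈ ; (there (there (here refl))) → D∈ }
      ; disjoint = (A∥B ∷ A∥D ∷ []) ∷ (B∥D ∷ []) ∷ [] ∷ []
      }) no3
    where
    a≢ : ∀ {E} → Disjoint A E → A ≢ E
    a≢ = disjoint⇒≢ (proj₂ (block-nonempty packing A∈))

  deg≤pencils : ∀ {A B} → A ∈ 𝓑 → B ∈ 𝓑 → Disjoint A B →
                ∀ x → deg 𝓑 x ≤ pencil 𝓑 (A ⊓_) x + pencil 𝓑 (B ⊓_) x
  deg≤pencils {A} {B} A∈ B∈ A∥B x = ≤-trans
    (deg≤pencil 𝓑 x λ D∈ _ → meets-pair A∈ B∈ D∈ A∥B)
    (≤-reflexive (pencil-+ 𝓑 (A ⊓_) (B ⊓_) x))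

  pencil⊓≤4 : ∀ {A x} → A ∈ 𝓑 → ¬ x Subset.∈ A → pencil 𝓑 (A ⊓_) x ≤ 4
  pencil⊓≤4 {A} {x} A∈ x∉A = subst (pencil 𝓑 (A ⊓_) x ≤_) (∣block∣ packing A∈) (pencil⊓≤∣∣ packing A x∉A)

  heavy-bound : ∀ {x} → v ≥ 50 → 9 ≤ deg 𝓑 x → 3 * length 𝓑 + 3 ≤ 2 * v
  heavy-bound {x} v≥50 9≤deg = +-cancelʳ-≤ d _ _ (begin
    3 * length 𝓑 + 3 + d           ≡⟨ cong (λ t → 3 * t + 3 + d) (length≡deg+avoid 𝓑 x) ⟩
    3 * (d + length 𝓨) + 3 + d     ≡⟨ rearrange d (length 𝓨) ⟩
    (4 * d + 1) + (3 * length 𝓨 + 2) ≤⟨ +-mono-≤ (deg-bound₀ packing x)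
                                         (intersecting-bound v≥50 (filter-packing avoid? packing)
                                           (λ D∈ → proj₂ (∈-filter⁻ avoid? {xs = 𝓑} D∈)) meets) ⟩
    (v + d) + v                    ≡⟨ double v d ⟩
    2 * v + d ∎)
    where
    open ≤-Reasoning
    d = deg 𝓑 x
    avoid? : ∀ D → Dec (¬ x Subset.∈ D)
    avoid? D = ¬? (x ∈? D)
    𝓨 = filter avoid? 𝓑
    rearrange : ∀ d e → 3 * (d + e) + 3 + d ≡ (4 * d + 1) + (3 * e + 2)
    rearrange = solve-∀
    double : ∀ v d → (v + d) + v ≡ 2 * v + d
    double = solve-∀
    meets : ∀ {A B} → A ∈ 𝓨 → B ∈ 𝓨 → 1 ≤ A ⊓ B
    meets {A} {B} A∈𝓨 B∈𝓨 with 1≤⊓⊎disjoint A B | ∈-filter⁻ avoid? A∈𝓨 | ∈-filter⁻ avoid? B∈𝓨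
    ... | inj₁ 1≤  | _ | _ = 1≤
    ... | inj₂ A∥B | A∈ , x∉A | B∈ , x∉B = contradiction
      -- Each block through `x` meets `A` or `B`, and at most 4 of them meet each, so `x` would have
      -- degree at most 8.
      (≤-trans 9≤deg (≤-trans (deg≤pencils A∈ B∈ A∥B x) (+-mono-≤ (pencil⊓≤4 A∈ x∉A) (pencil⊓≤4 B∈ x∉B))))
      1+n≰n

  module _ (deg≤8 : ∀ z → deg 𝓑 z ≤ 8) where

    ∑deg≤32 : ∀ {A} → A ∈ 𝓑 → (∑[ D ∈ 𝓑 ] (A ⊓ D)) ≤ 32
    ∑deg≤32 {A} A∈ = begin
      (∑[ D ∈ 𝓑 ] (A ⊓ D))                     ≡⟨ ∑deg 𝓑 A ⟨
      (∑[ z ∈ allFin v ] (ι A z * deg 𝓑 z))    ≤⟨ ∑-mono (allFin v) (λ {z} _ → *-monoʳ-≤ (ι A z) (deg≤8 z)) ⟩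
      (∑[ z ∈ allFin v ] (ι A z * 8))          ≡⟨ ∑-*ʳ (allFin v) 8 (ι A) ⟩
      ∑ (allFin v) (ι A) * 8                   ≡⟨ cong (_* 8) (trans (∑ι≡∣∣ A) (∣block∣ packing A∈)) ⟩
      32 ∎
      where open ≤-Reasoning

    -- With p = |A ∩ D| and q = |C ∩ D| every block D has 1 + q p ≤ p + q.  The sum of q p over all D counts, for
    -- z ∈ C, the blocks through z that meet A; if z ∉ B these are all but at most 4 of the blocks through z.
    light-bound : ∀ {A B C} → A ∈ 𝓑 → B ∈ 𝓑 → C ∈ 𝓑 → Disjoint A B → Disjoint A C → B ≢ C →
                  length 𝓑 ≤ 52
    light-bound {A} {B} {C} A∈ B∈ C∈ A∥B A∥C B≢C = +-cancelʳ-≤ S _ _ (begin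
      length 𝓑 + S                                    ≡⟨ cong₂ _+_ (sym (trans (∑-const 𝓑 1) (*-identityʳ _)))
                                                                  (double-count 𝓑 (ι C) (A ⊓_)) ⟩
      (∑[ _ ∈ 𝓑 ] 1) + (∑[ D ∈ 𝓑 ] (C ⊓ D * A ⊓ D))    ≡⟨ ∑-+ 𝓑 _ _ ⟨
      (∑[ D ∈ 𝓑 ] (1 + C ⊓ D * A ⊓ D))                 ≤⟨ ∑-mono 𝓑 cross ⟩
      (∑[ D ∈ 𝓑 ] (A ⊓ D + C ⊓ D))                     ≡⟨ ∑-+ 𝓑 (A ⊓_) (C ⊓_) ⟩
      (∑[ D ∈ 𝓑 ] (A ⊓ D)) + (∑[ D ∈ 𝓑 ] (C ⊓ D))      ≤⟨ +-mono-≤ (∑deg≤32 A∈) ∑C≤ ⟩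
      32 + (S + 20)                                   ≡⟨ rearrange S ⟩
      52 + S ∎)
      where
      open ≤-Reasoning
      s = pencil 𝓑 (A ⊓_)
      S = ∑[ z ∈ allFin v ] (ι C z * s z)
      rearrange : ∀ n → 32 + (n + 20) ≡ 52 + n
      rearrange = solve-∀

      -- Over the integers this says `(p - 1) * (q - 1) ≤ 0`. It fails only if `p` and `q` are both
      -- 0 or both at least 2, and the two hypotheses exclude these cases.
      1+qp≤p+q : ∀ p q → 1 ≤ p + q → p ≤ 1 ⊎ q ≡ 0 → 1 + q * p ≤ p + q
      1+qp≤p+q zero          q 1≤ _ = ≤-trans (≤-reflexive (cong suc (*-zeroʳ q))) 1≤
      1+qp≤p+q (suc zero)    q 1≤ _ = ≤-reflexive (cong suc (*-identityʳ q))
      1+qp≤p+q (suc (suc p)) q 1≤ (inj₁ (s≤s ()))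
      1+qp≤p+q (suc (suc p)) _ 1≤ (inj₂ refl) = s≤s z≤n

      cross : ∀ {D} → D ∈ 𝓑 → 1 + C ⊓ D * A ⊓ D ≤ A ⊓ D + C ⊓ D
      cross {D} D∈ = 1+qp≤p+q (A ⊓ D) (C ⊓ D) (meets-pair A∈ C∈ D∈ A∥C) small
        where
        -- Only `D = A` can meet `A` in more than one point, and `A` is disjoint from `C`.
        small : A ⊓ D ≤ 1 ⊎ C ⊓ D ≡ 0
        small with A ≟ˢ D
        ... | yes refl = inj₂ (disjoint⇒⊓≡0 (disjoint-sym A∥C))
        ... | no  A≢D  = inj₁ (⊓≤1 packing A∈ D∈ A≢D)

      -- At a point of `B` the allowance is the full degree bound 8, elsewhere 4. At most one of the
      -- 4 points of `C` is on `B`, so the allowances add up to at most 20.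
      deg≤ : ∀ {z} → z Subset.∈ C → deg 𝓑 z ≤ s z + (4 + 4 * ι B z)
      deg≤ {z} z∈C with z ∈? B
      ... | yes z∈B rewrite ∈⇒ι≡1 z∈B = ≤-trans (deg≤8 z) (m≤n+m 8 (s z))
      ... | no  z∉B rewrite ∉⇒ι≡0 z∉B =
        ≤-trans (deg≤pencils A∈ B∈ A∥B z) (+-monoʳ-≤ (s z) (pencil⊓≤4 B∈ z∉B))

      term : ∀ z → ι C z * deg 𝓑 z ≤ ι C z * s z + (4 * ι C z + 4 * (ι B z * ι C z))
      term z with z ∈? C
      ... | yes z∈C rewrite ∈⇒ι≡1 z∈C = ≤-trans (*-monoʳ-≤ 1 (deg≤ z∈C)) (≤-reflexive (expand (s z) (ι B z)))
        where
        expand : ∀ a b → 1 * (a + (4 + 4 * b)) ≡ 1 * a + (4 * 1 + 4 * (b * 1))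
        expand = solve-∀
      ... | no  z∉C rewrite ∉⇒ι≡0 z∉C = z≤n

      ∑C≤ : (∑[ D ∈ 𝓑 ] (C ⊓ D)) ≤ S + 20
      ∑C≤ = begin
        (∑[ D ∈ 𝓑 ] (C ⊓ D))                                    ≡⟨ ∑deg 𝓑 C ⟨
        (∑[ z ∈ allFin v ] (ι C z * deg 𝓑 z))                   ≤⟨ ∑-mono (allFin v) (λ {z} _ → term z) ⟩
        (∑[ z ∈ allFin v ] (ι C z * s z + (4 * ι C z + 4 * (ι B z * ι C z))))
          ≡⟨ trans (∑-+ (allFin v) _ _) (cong (S +_) (trans (∑-+ (allFin v) _ _)
               (cong₂ _+_ (∑-*ˡ (allFin v) 4 _) (∑-*ˡ (allFin v) 4 _)))) ⟩
        S + (4 * ∑ (allFin v) (ι C) + 4 * B ⊓ C)                ≡⟨ cong (λ t → S + (4 * t + 4 * B ⊓ C))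
                                                                     (trans (∑ι≡∣∣ C) (∣block∣ packing C∈)) ⟩
        S + (16 + 4 * B ⊓ C)                                    ≤⟨ +-monoʳ-≤ S (+-monoʳ-≤ 16
                                                                     (*-monoʳ-≤ 4 (⊓≤1 packing B∈ C∈ B≢C))) ⟩
        S + 20 ∎

    light-length : HasPPC 𝓑 2 → length 𝓑 ≤ 52
    light-length (A ∷ B ∷ [] , refl , ppc) = go (IsPPC.disjoint ppc)
      where
      A∈ = IsPPC.blocks ppc (here refl)
      B∈ = IsPPC.blocks ppc (there (here refl))
      go : AllPairs Disjoint (A ∷ B ∷ []) → length 𝓑 ≤ 52
      go ((A∥B ∷ []) ∷ _) with any? (λ C → ¬? (B ≟ˢ C) ×-dec ¬? (nonempty? (A ∩ C))) 𝓑
      ... | yes C∃ = let C , C∈ , B≢C , A∥C = find C∃ in light-bound A∈ B∈ C∈ A∥B A∥C B≢C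
      ... | no ¬C  = begin
          length 𝓑                            ≡⟨ trans (∑-const 𝓑 1) (*-identityʳ _) ⟨
          (∑[ _ ∈ 𝓑 ] 1)                      ≤⟨ ∑-mono 𝓑 meets ⟩
          -- Only `B` is disjoint from `A` here; the term `ι D y` for a point `y` of `B` makes up
          -- for it.
          (∑[ D ∈ 𝓑 ] (A ⊓ D + ι D y))        ≡⟨ ∑-+ 𝓑 _ _ ⟩
          (∑[ D ∈ 𝓑 ] (A ⊓ D)) + deg 𝓑 y      ≤⟨ +-mono-≤ (∑deg≤32 A∈) (deg≤8 y) ⟩
          40                                  ≤⟨ ≤ᵇ⇒≤ 40 52 _ ⟩
          52 ∎
        where
        open ≤-Reasoning
        y = proj₁ (block-nonempty packing B∈)
        meets : ∀ {D} → D ∈ 𝓑 → 1 ≤ A ⊓ D + ι D y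
        meets {D} D∈ with 1≤⊓⊎disjoint A D | B ≟ˢ D
        ... | inj₁ 1≤  | _        = ≤-trans 1≤ (m≤m+n _ _)
        ... | inj₂ _   | yes refl =
          ≤-trans (≤-reflexive (sym (∈⇒ι≡1 (proj₂ (block-nonempty packing B∈))))) (m≤n+m _ (A ⊓ B))
        ... | inj₂ A∥D | no B≢D   = contradiction (lose D∈ (B≢D , A∥D)) ¬C

  packing-bound : v ≥ 81 → HasPPC 𝓑 2 → 3 * length 𝓑 + 3 ≤ 2 * v
  packing-bound v≥81 ppc with Fin.any? (λ x → 9 ≤? deg 𝓑 x)
  ... | yes (x , 9≤deg) = heavy-bound (≤-trans (≤ᵇ⇒≤ 50 81 _) v≥81) 9≤deg
  ... | no  ¬heavy = begin
    3 * length 𝓑 + 3  ≤⟨ +-monoˡ-≤ 3 (*-monoʳ-≤ 3 (light-length (λ z → ≮⇒≥ λ 9≤deg → ¬heavy (z , 9≤deg)) ppc)) ⟩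
    -- `3 * 52 + 3 = 159` lies below `2 * 81 = 162`.
    159               ≤⟨ ≤ᵇ⇒≤ 159 162 _ ⟩
    2 * 81            ≤⟨ *-monoʳ-≤ 2 v≥81 ⟩
    2 * v ∎
    where open ≤-Reasoning

β-attained⇒≤ : v ≥ 81 → Attained 2 v 4 (β 2 v 4) → β 2 v 4 ≤ (2 * v ∸ 3) / 3
β-attained⇒≤ {v} v≥81 (𝓑 , length≡β , packing , ppc , no3) = begin
  β 2 v 4              ≡⟨ m*n/n≡m (β 2 v 4) 3 ⟨
  β 2 v 4 * 3 / 3      ≤⟨ /-monoˡ-≤ 3 (m+n≤o⇒m≤o∸n (β 2 v 4 * 3) bound) ⟩
  (2 * v ∸ 3) / 3 ∎
  where
  open ≤-Reasoning
  bound : β 2 v 4 * 3 + 3 ≤ 2 * v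
  bound = begin
    β 2 v 4 * 3 + 3    ≡⟨ cong (_+ 3) (trans (*-comm (β 2 v 4) 3) (cong (3 *_) (sym length≡β))) ⟩
    3 * length 𝓑 + 3   ≤⟨ packing-bound packing no3 v≥81 ppc ⟩
    2 * v ∎

-- Subsets given as images of injections.

image : ∀ {n} → (Fin n → Fin v) → Subset v
image {n = zero}  f = ⊥
image {n = suc n} f = ⁅ f zero ⁆ ∪ image (f ∘ suc)

∈-image⁺ : ∀ {n} (f : Fin n → Fin v) i → f i Subset.∈ image f
∈-image⁺ f zero    = x∈p∪q⁺ (inj₁ (x∈⁅x⁆ (f zero)))
∈-image⁺ f (suc i) = x∈p∪q⁺ (inj₂ (∈-image⁺ (f ∘ suc) i))

∈-image⁻ : ∀ {n} (f : Fin n → Fin v) {x} → x Subset.∈ image f → ∃ λ i → f i ≡ x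
∈-image⁻ {n = zero}  f x∈ = contradiction x∈ ∉⊥
∈-image⁻ {n = suc n} f x∈ with x∈p∪q⁻ ⁅ f zero ⁆ _ x∈
... | inj₁ x∈₁ = zero , sym (x∈⁅y⁆⇒x≡y _ x∈₁)
... | inj₂ x∈₂ = let i , eq = ∈-image⁻ (f ∘ suc) x∈₂ in suc i , eq

∣⁅x⁆∪p∣ : ∀ (x : Fin v) p → ¬ x Subset.∈ p → ∣ ⁅ x ⁆ ∪ p ∣ ≡ suc ∣ p ∣
∣⁅x⁆∪p∣ zero    (inside  ∷ p) x∉ = contradiction Vec.here x∉
∣⁅x⁆∪p∣ zero    (outside ∷ p) x∉ = cong (suc ∘ ∣_∣) (∪-identityˡ p)
∣⁅x⁆∪p∣ (suc x) (inside  ∷ p) x∉ = cong suc (∣⁅x⁆∪p∣ x p (x∉ ∘ Vec.there))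
∣⁅x⁆∪p∣ (suc x) (outside ∷ p) x∉ = ∣⁅x⁆∪p∣ x p (x∉ ∘ Vec.there)

∣image∣ : ∀ {n} (f : Fin n → Fin v) → Injective _≡_ _≡_ f → ∣ image f ∣ ≡ n
∣image∣ {v} {zero}  f inj = ∣⊥∣≡0 v
∣image∣ {v} {suc n} f inj = trans
  (∣⁅x⁆∪p∣ (f zero) _ λ f0∈ → let i , eq = ∈-image⁻ (f ∘ suc) f0∈ in 0≢1+n (inj (sym eq)))
  (cong suc (∣image∣ (f ∘ suc) (Fin.suc-injective ∘ inj)))

-- Adding (d − 1) a to both sides turns a + _ into _ modulo d without subtraction.
+-cancelˡ-% : ∀ d .{{_ : NonZero d}} a b c → (a + b) % d ≡ (a + c) % d → b % d ≡ c % d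
+-cancelˡ-% (suc d) a b c eq = trans (sym (reduce b)) (trans (shift eq) (reduce c))
  where
  rearrange : ∀ d a b → d * a + (a + b) ≡ b + a * suc d
  rearrange = solve-∀
  reduce : ∀ b → (d * a + (a + b)) % suc d ≡ b % suc d
  reduce b = trans (cong (_% suc d) (rearrange d a b)) ([m+kn]%n≡m%n b a (suc d))
  shift : ∀ {b c} → b % suc d ≡ c % suc d → (d * a + b) % suc d ≡ (d * a + c) % suc d
  shift {b} {c} b≡c = trans (%-distribˡ-+ (d * a) b (suc d))
    (trans (cong (λ t → ((d * a) % suc d + t) % suc d) b≡c) (sym (%-distribˡ-+ (d * a) c (suc d))))

length-cartesianProduct : ∀ (xs : List X) (ys : List Y) →
                          length (cartesianProduct xs ys) ≡ length xs * length ys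
length-cartesianProduct []       ys = refl
length-cartesianProduct (x ∷ xs) ys = trans (length-++ (map (x ,_) ys))
  (cong₂ _+_ (length-map (x ,_) ys) (length-cartesianProduct xs ys))

-- Two parallel classes of triples, each extended by a new point.

module _ (n : ℕ) where

  private
    -- With `m` at least 4 the offsets 0, 1, 2 are distinct modulo `m`, and 1, 2, 3 are nonzero
    -- modulo `m`, as the disjoint pair in `blocks-maxPPC` requires.
    m = 4 + n

  shift : Fin m → Fin 3 → Fin m
  shift i j = fromℕ< (m%n<n (toℕ i + toℕ j) m)

  toℕ-shift : ∀ i j → toℕ (shift i j) ≡ (toℕ i + toℕ j) % m
  toℕ-shift i j = toℕ-fromℕ< _

  shift-injectiveˡ : ∀ {i i′} j → shift i j ≡ shift i′ j → i ≡ i′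
  shift-injectiveˡ {i} {i′} j eq = toℕ-injective
    (trans (sym (m<n⇒m%n≡m (toℕ<n i))) (trans
      (+-cancelˡ-% m (toℕ j) (toℕ i) (toℕ i′) (trans (comm i) (trans (cong toℕ eq) (sym (comm i′)))))
      (m<n⇒m%n≡m (toℕ<n i′))))
    where
    comm : ∀ i → (toℕ j + toℕ i) % m ≡ toℕ (shift i j)
    comm i = trans (cong (_% m) (+-comm (toℕ j) (toℕ i))) (sym (toℕ-shift i j))

  shift-injectiveʳ : ∀ i {j j′} → shift i j ≡ shift i j′ → j ≡ j′
  shift-injectiveʳ i {j} {j′} eq = toℕ-injective
    (trans (sym (small j)) (trans
      (+-cancelˡ-% m (toℕ i) (toℕ j) (toℕ j′)
        (trans (sym (toℕ-shift i j)) (trans (cong toℕ eq) (toℕ-shift i j′))))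
      (small j′)))
    where
    small : ∀ j → toℕ j % m ≡ toℕ j
    small j = m<n⇒m%n≡m (<-trans (toℕ<n j) (s≤s (s≤s (s≤s (s≤s z≤n)))))

  -- The first parallel class consists of the triples {(i , j) : j < 3}, the second of the {(i + j mod m , j) : j < 3}.
  transversal : Fin 2 → Fin m → Fin 3 → Fin m
  transversal zero       i j = i
  transversal (suc zero) i j = shift i j

  transversal-injective : ∀ t {i i′} j → transversal t i j ≡ transversal t i′ j → i ≡ i′
  transversal-injective zero       j eq = eq
  transversal-injective (suc zero) j eq = shift-injectiveˡ j eq

  -- `inj₁ t` is the new point of class `t`; `inj₂ (i , j)` is the entry in row `i` and column `j`
  -- of an array from which each triple takes one entry per column.
  Point : Set
  Point = Fin 2 ⊎ (Fin m × Fin 3)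

  block-point : Fin 2 × Fin m → Fin 4 → Point
  block-point (t , i) zero    = inj₁ t
  block-point (t , i) (suc j) = inj₂ (transversal t i j , j)

  -- The point alone reveals its position: new points are at position `zero`, entries of column `j`
  -- at `suc j`. Hence a common point has the same position in both blocks.
  block-point-index : ∀ b b′ {a a′} → block-point b a ≡ block-point b′ a′ → a ≡ a′
  block-point-index b b′ {zero}  {zero}   eq = refl
  block-point-index b b′ {suc j} {suc j′} eq = cong suc (proj₂ (,-injective (inj₂-injective eq)))
  block-point-index b b′ {zero}  {suc j′} ()
  block-point-index b b′ {suc j} {zero}   ()

  -- Within a class one array entry determines the triple, and a shared new point forces the same
  -- class. For blocks of different classes, two shared entries would give one row two equal shifts,
  -- hence equal columns.
  two-points : ∀ b b′ {a c} → a ≢ c → block-point b a ≡ block-point b′ a → block-point b c ≡ block-point b′ c → b ≡ b′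
  two-points b b′ {zero} {zero} a≢c _ _ = contradiction refl a≢c
  two-points (t , i) (t′ , i′) {zero} {suc j} _ refl eq =
    cong (t ,_) (transversal-injective t j (,-injectiveˡ (inj₂-injective eq)))
  two-points (t , i) (t′ , i′) {suc j} {zero} _ eq refl =
    cong (t ,_) (transversal-injective t j (,-injectiveˡ (inj₂-injective eq)))
  two-points (zero , i) (zero , i′) {suc j} {suc k} _ refl _ = refl
  two-points (suc zero , i) (suc zero , i′) {suc j} {suc k} _ eq _ =
    cong (suc zero ,_) (shift-injectiveˡ j (,-injectiveˡ (inj₂-injective eq)))
  two-points (zero , i) (suc zero , i′) {suc j} {suc k} a≢c eq eq′ = contradiction (cong suc (shift-injectiveʳ i′
    (trans (sym (,-injectiveˡ (inj₂-injective eq))) (,-injectiveˡ (inj₂-injective eq′))))) a≢c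
  two-points (suc zero , i) (zero , i′) {suc j} {suc k} a≢c eq eq′ = contradiction (cong suc (shift-injectiveʳ i
    (trans (,-injectiveˡ (inj₂-injective eq)) (sym (,-injectiveˡ (inj₂-injective eq′)))))) a≢c

  module _ (v≥ : 2 + m * 3 ≤ v) where

    point : Point → Fin v
    point p = inject≤ (join 2 (m * 3) (map₂ (uncurry combine) p)) v≥

    point-injective : Injective _≡_ _≡_ point
    point-injective {p} {q} eq = map₂-injective p q (trans (sym (splitAt-join 2 (m * 3) _))
      (trans (cong (splitAt 2) (inject≤-injective v≥ v≥ _ _ eq)) (splitAt-join 2 (m * 3) _)))
      where
      map₂-injective : ∀ p q → map₂ (uncurry combine) p ≡ map₂ (uncurry combine) q → p ≡ q
      map₂-injective (inj₁ _) (inj₁ _) refl = refl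
      map₂-injective (inj₂ (i , j)) (inj₂ (i′ , j′)) eq =
        cong inj₂ (uncurry (cong₂ _,_) (combine-injective i j i′ j′ (inj₂-injective eq)))
      map₂-injective (inj₁ _) (inj₂ _) ()
      map₂-injective (inj₂ _) (inj₁ _) ()

    block : Fin 2 × Fin m → Subset v
    block b = image (point ∘ block-point b)

    ∈-block : ∀ b {x} → x Subset.∈ block b → ∃ λ a → point (block-point b a) ≡ x
    ∈-block b = ∈-image⁻ (point ∘ block-point b)

    common-point : ∀ b b′ {x} → x Subset.∈ block b → x Subset.∈ block b′ →
                   ∃ λ a → block-point b a ≡ block-point b′ a × point (block-point b a) ≡ x
    common-point b b′ x∈b x∈b′ with ∈-block b x∈b | ∈-block b′ x∈b′
    ... | a , refl | a′ , eq with refl ← block-point-index b′ b {a′} {a} (point-injective eq) =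
      a , sym (point-injective eq) , refl

    ∞∈ : ∀ t i → point (inj₁ t) Subset.∈ block (t , i)
    ∞∈ t i = ∈-image⁺ (point ∘ block-point (t , i)) zero

    block-injective : Injective _≡_ _≡_ block
    block-injective {b} {b′} eq = two-points b b′ {zero} {suc zero} (λ ()) (same zero) (same (suc zero))
      where
      a∈ = ∈-image⁺ (point ∘ block-point b)
      same : ∀ a → block-point b a ≡ block-point b′ a
      same a with common-point b b′ (a∈ a) (subst (point (block-point b a) Subset.∈_) eq (a∈ a))
      ... | a′ , same′ , pt with refl ← block-point-index b b {a′} {a}
                                           (point-injective {block-point b a′} {block-point b a} pt) = same′

    indices : List (Fin 2 × Fin m)
    indices = cartesianProduct (allFin 2) (allFin m)

    blocks : List (Subset v)
    blocks = map block indices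

    length-blocks : length blocks ≡ 2 * m
    length-blocks = trans (length-map block indices) (trans (length-cartesianProduct (allFin 2) (allFin m))
      (cong₂ _*_ (length-tabulate {n = 2} id) (length-tabulate {n = m} id)))

    ∈-blocks⁺ : ∀ t i → block (t , i) ∈ blocks
    ∈-blocks⁺ t i = ∈-map⁺ block (∈-cartesianProduct⁺ (∈-allFin t) (∈-allFin i))

    ∈-blocks⁻ : ∀ {B} → B ∈ blocks → ∃ λ b → B ≡ block b
    ∈-blocks⁻ B∈ = let b , _ , eq = ∈-map⁻ block {xs = indices} B∈ in b , eq

    blocks-packing : IsPacking v 4 blocks
    blocks-packing = record
      { distinct   = Unique.map⁺ (λ {b} {b′} → block-injective {b} {b′}) (Unique.cartesianProduct⁺ (allFin⁺ 2) (allFin⁺ m))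
      ; block-size = All.tabulate λ B∈ → size (∈-blocks⁻ B∈)
      ; pair       = λ x≢y B∈ C∈ → pair′ x≢y (∈-blocks⁻ B∈) (∈-blocks⁻ C∈)
      }
      where
      size : ∀ {B} → (∃ λ b → B ≡ block b) → ∣ B ∣ ≡ 4
      size (b , refl) = ∣image∣ _ (block-point-index b b ∘ point-injective)
      pair′ : ∀ {x y} → x ≢ y → ∀ {B C} → (∃ λ b → B ≡ block b) → (∃ λ c → C ≡ block c) →
              x Subset.∈ B → y Subset.∈ B → x Subset.∈ C → y Subset.∈ C → B ≡ C
      pair′ x≢y (b , refl) (c , refl) x∈B y∈B x∈C y∈C with common-point b c x∈B x∈C | common-point b c y∈B y∈C
      ... | a , eq , refl | a′ , eq′ , refl = cong block (two-points b c (λ { refl → x≢y refl }) eq eq′)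

    same-centre : ∀ {B C} t i i′ → B ≡ block (t , i) → C ≡ block (t , i′) → ¬ Disjoint B C
    same-centre t i i′ refl refl dis = dis (point (inj₁ t) , x∈p∩q⁺ (∞∈ t i , ∞∈ t i′))

    -- Of any three blocks two belong to the same class and share its new point.
    blocks-maxPPC : MaxPPCSize blocks 2
    blocks-maxPPC = (B ∷ C ∷ [] , refl , record
      { distinct = (B≢C ∷ []) ∷ [] ∷ []
      ; blocks   = λ { (here refl) → ∈-blocks⁺ zero zero ; (there (here refl)) → ∈-blocks⁺ (suc zero) (suc zero) }
      ; disjoint = (B∥C ∷ []) ∷ [] ∷ []
      }) , no-three
      where
      b c : Fin 2 × Fin m
      b = zero , zero
      -- This block uses rows 1, 2 and 3, while `b` uses only row 0. Index 0 of the second class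
      -- would share the entry in row 0, column 0 with `b`.
      c = suc zero , suc zero
      B = block b
      C = block c
      B≢C : B ≢ C
      B≢C eq with () ← block-injective {b} {c} eq
      B∥C : Disjoint B C
      B∥C (x , x∈) with common-point b c (proj₁ (x∈p∩q⁻ B C x∈)) (proj₂ (x∈p∩q⁻ B C x∈))
      ... | zero , () , _
      ... | suc j , eq , _ = 0≢shift j (,-injectiveˡ (inj₂-injective eq))
        where
        0≢shift : ∀ j → zero ≢ shift (suc zero) j
        0≢shift zero             ()
        0≢shift (suc zero)       ()
        0≢shift (suc (suc zero)) ()
      no-three : ¬ HasPPC blocks 3
      no-three (A ∷ B ∷ C ∷ [] , refl , ppc) with IsPPC.disjoint ppc
         | ∈-blocks⁻ (IsPPC.blocks ppc (here refl)) | ∈-blocks⁻ (IsPPC.blocks ppc (there (here refl)))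
         | ∈-blocks⁻ (IsPPC.blocks ppc (there (there (here refl))))
      ... | (A∥B ∷ A∥C ∷ []) ∷ (B∥C ∷ []) ∷ _ | (t₁ , i₁) , eq₁ | (t₂ , i₂) , eq₂ | (t₃ , i₃) , eq₃
        with t₁ | t₂ | t₃
      ... | zero     | zero     | _        = same-centre zero i₁ i₂ eq₁ eq₂ A∥B
      ... | zero     | suc zero | zero     = same-centre zero i₁ i₃ eq₁ eq₃ A∥C
      ... | zero     | suc zero | suc zero = same-centre (suc zero) i₂ i₃ eq₂ eq₃ B∥C
      ... | suc zero | suc zero | _        = same-centre (suc zero) i₁ i₂ eq₁ eq₂ A∥B
      ... | suc zero | zero     | suc zero = same-centre (suc zero) i₁ i₃ eq₁ eq₃ A∥C
      ... | suc zero | zero     | zero     = same-centre zero i₂ i₃ eq₂ eq₃ B∥C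

-- Lower bound by residue classes modulo 3.

attained-2m : ∀ {m} → 4 ≤ m → 2 + m * 3 ≤ v → Attained 2 v 4 (2 * m)
attained-2m (s≤s (s≤s (s≤s (s≤s {n = n} z≤n)))) v≥ =
  blocks n v≥ , length-blocks n v≥ , blocks-packing n v≥ , blocks-maxPPC n v≥

-- The construction has `2 * m` blocks, and `c` absorbs the difference between `2 * v` and three
-- times that number.
lower-bound : ∀ m c → 4 ≤ m → 2 + m * 3 ≤ v → 2 * v ≤ 2 * m * 3 + c → (2 * v ∸ c) / 3 ≤ β 2 v 4
lower-bound {v} m c 4≤m v≥ 2v≤ = begin
  (2 * v ∸ c) / 3   ≤⟨ /-monoˡ-≤ 3 (≤-trans (∸-monoˡ-≤ c 2v≤) (≤-reflexive (m+n∸n≡m (2 * m * 3) c))) ⟩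
  2 * m * 3 / 3     ≡⟨ m*n/n≡m (2 * m) 3 ⟩
  2 * m             ≤⟨ ≤β 2 v 4 (attained-2m 4≤m v≥) ⟩
  β 2 v 4 ∎
  where open ≤-Reasoning

theorem4p2 : (v : ℕ) → v ≥ 81 →
    (β 2 v 4 ≤ (2 * v ∸ 3) / 3)
    × (v % 3 ≡ 0 → (2 * v ∸ 6) / 3 ≤ β 2 v 4)
    × (v % 3 ≡ 1 → (2 * v ∸ 8) / 3 ≤ β 2 v 4)
    × (v % 3 ≡ 2 → (2 * v ∸ 4) / 3 ≤ β 2 v 4)
theorem4p2 v v≥81 =
    -- `β` is known to be attained once some value is, which rules out its default 0; `m = 26`
    -- provides one, as `2 + 26 * 3 = 80`.
    β-attained⇒≤ v≥81 (β-attained 2 v 4 (attained-2m (≤ᵇ⇒≤ 4 26 _) (≤-trans (n≤1+n 80) v≥81)))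
  , residues (v / 3) (/-monoˡ-≤ 3 v≥81) (m≡m%n+[m/n]*n v 3)
  where
  residues : ∀ q → 27 ≤ q → v ≡ v % 3 + q * 3 →
    (v % 3 ≡ 0 → (2 * v ∸ 6) / 3 ≤ β 2 v 4)
    × (v % 3 ≡ 1 → (2 * v ∸ 8) / 3 ≤ β 2 v 4)
    × (v % 3 ≡ 2 → (2 * v ∸ 4) / 3 ≤ β 2 v 4)
  residues (suc p) (s≤s 26≤p) v≡ =
      -- With `v = r + 3 * suc p`, the two new points are the spare ones if `r` is 2, so
      -- `m = suc p`. For `r` equal to 0 or 1 a row is given up and `m = p`. The constants 6, 8, 4
      -- are `2 * v - 6 * m`.
      (λ r≡0 → bound p 6 0 4≤p (with-residue r≡0) (m≤n+m _ 1) (twice₀ p))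
    , (λ r≡1 → bound p 8 1 4≤p (with-residue r≡1) (m≤n+m _ 2) (twice₁ p))
    , (λ r≡2 → bound (suc p) 4 2 (m≤n⇒m≤1+n 4≤p) (with-residue r≡2) ≤-refl (twice₂ p))
    where
    4≤p : 4 ≤ p
    4≤p = ≤-trans (≤ᵇ⇒≤ 4 26 _) 26≤p
    with-residue : ∀ {r} → v % 3 ≡ r → v ≡ r + suc p * 3
    with-residue r≡ = trans v≡ (cong (_+ suc p * 3) r≡)
    twice₀ : ∀ p → 2 * (0 + suc p * 3) ≡ 2 * p * 3 + 6
    twice₀ = solve-∀
    twice₁ : ∀ p → 2 * (1 + suc p * 3) ≡ 2 * p * 3 + 8
    twice₁ = solve-∀
    twice₂ : ∀ p → 2 * (2 + suc p * 3) ≡ 2 * suc p * 3 + 4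
    twice₂ = solve-∀
    bound : ∀ m c r → 4 ≤ m → v ≡ r + suc p * 3 → 2 + m * 3 ≤ r + suc p * 3 →
            2 * (r + suc p * 3) ≡ 2 * m * 3 + c → (2 * v ∸ c) / 3 ≤ β 2 v 4
    bound m c r 4≤m v≡ fits twice = lower-bound m c 4≤m
      (≤-trans fits (≤-reflexive (sym v≡))) (≤-reflexive (trans (cong (2 *_) v≡) twice))
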